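{- Let $A$ be a reduced ring and let $M$ be an injective matrix over $A$ with more columns than rows. Then $1=0$ in $A$.
   Context: The metatheory is constructive (no law of excluded middle, no axiom of choice). A ring is a commutative ring with unit; the unit is not required to be distinct from zero. A ring is reduced iff $x^n=0$ implies $x=0$. A matrix $M\in A^{n\times m}$ ($n$ rows, $m$ columns) is injective iff the induced linear map $A^m\to A^n$ is injective. -}

module Defs where

open import Algebra.Bundles using (CommutativeRing; Semiring)
import Algebra.Definitions.RawSemiring as RawSemiringDefinitions
open import Data.Nat.Base using (ℕ)
open import Data.Vec.Functional using (Vector)
import Data.Vec.Functional.Relation.Binary.Equality.Setoid as VectorEquality
open import Function.Definitions using (Injective)
open import Level using (Level; _⊔_)

module _ {c ℓ : Level} (A : CommutativeRing c ℓ) where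
  open CommutativeRing A
  open RawSemiringDefinitions (Semiring.rawSemiring semiring) using (_^_; sum)
  open VectorEquality setoid using (_≋_)

  IsReduced : Set (c ⊔ ℓ)
  IsReduced = ∀ (x : Carrier) (n : ℕ) → x ^ n ≈ 0# → x ≈ 0#

  -- n rows, m columns.
  Matrix : ℕ → ℕ → Set c
  Matrix n m = Vector (Vector Carrier m) n

  -- The linear map Aᵐ → Aⁿ, v ↦ M v.
  apply : {n m : ℕ} → Matrix n m → Vector Carrier m → Vector Carrier n
  apply M v i = sum (λ j → M i j * v j)

  IsInjectiveMatrix : {n m : ℕ} → Matrix n m → Set (c ⊔ ℓ)
  IsInjectiveMatrix M = Injective _≋_ _≋_ (apply M)

{-# OPTIONS --safe #-}
-- Injectivity is relaxed to "M v = 0 implies s v = 0", from which s = 0 is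
-- shown by induction on the number of rows; s plays the part of a localisation
-- at s, and s = 1 gives the theorem.  For any entry a of the first row,
-- division-free elimination with pivot a removes a row and a column and
-- preserves the hypothesis with s a in place of s, so s a = 0.  Hence s kills
-- the first row, which can then be dropped because s² v = 0 implies s v = 0
-- over a reduced ring.
module Submission where

open import Defs
open import Algebra.Bundles using (CommutativeRing)
open import Data.Nat.Base using (ℕ; zero; suc; _<_; s<s⁻¹)
open import Data.Nat.Properties using (m<n⇒m<1+n)
open import Level using (Level; _⊔_)
import Algebra.Properties.CommutativeSemigroup as CommutativeSemigroupProperties
import Algebra.Properties.Ring as RingProperties
import Algebra.Properties.Semiring.Sum as SemiringSum
import Algebra.Solver.Ring.NaturalCoefficients.Default as SemiringSolver
open import Data.Fin.Base using (Fin; zero; suc; punchIn)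
open import Data.Vec.Functional using (Vector; insertAt; removeAt; tail)
open import Data.Vec.Functional.Properties using (insertAt-lookup; insertAt-punchIn)
import Relation.Binary.Reasoning.Setoid as SetoidReasoning

module _ {c ℓ : Level} (A : CommutativeRing c ℓ) where
  open CommutativeRing A hiding (zero)
  open RingProperties ring using (-‿distribˡ-*; -‿distribʳ-*)
  open CommutativeSemigroupProperties *-commutativeSemigroup using (x∙yz≈y∙xz)
  open SemiringSum semiring
  open SemiringSolver commutativeSemiring using (solve; _:=_; _:+_; _:*_)
  open SetoidReasoning setoid

  IsInjectiveUpTo : {n m : ℕ} → Carrier → Matrix A n m → Set (c ⊔ ℓ)
  IsInjectiveUpTo s M =
    ∀ v → (∀ i → apply A M v i ≈ 0#) → ∀ j → s * v j ≈ 0#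

  sum-zero : ∀ {m} {f : Vector Carrier m} → (∀ j → f j ≈ 0#) → sum f ≈ 0#
  sum-zero {m} f≈0 = trans (sum-cong-≋ f≈0) (sum-replicate-zero m)

  apply-scale : ∀ {n m} (M : Matrix A n m) s v i →
    apply A M (λ j → s * v j) i ≈ s * apply A M v i
  apply-scale M s v i = begin
    sum (λ j → M i j * (s * v j))  ≈⟨ sum-cong-≋ (λ j → x∙yz≈y∙xz (M i j) s (v j)) ⟩
    sum (λ j → s * (M i j * v j))  ≈⟨ *-distribˡ-sum s (λ j → M i j * v j) ⟨
    s * apply A M v i              ∎

  apply-insertAt : ∀ {n m} (M : Matrix A n (suc m)) v j x i →
    apply A M (insertAt v j x) i ≈ M i j * x + apply A (λ i → removeAt (M i) j) v i
  apply-insertAt M v j x i = begin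
    apply A M (insertAt v j x) i
      ≈⟨ sum-remove {i = j} (λ k → M i k * insertAt v j x k) ⟩
    M i j * insertAt v j x j + sum (λ k → M i (punchIn j k) * insertAt v j x (punchIn j k))
      ≈⟨ +-cong (*-congˡ (reflexive (insertAt-lookup v j x)))
                (sum-cong-≋ (λ k → *-congˡ (reflexive (insertAt-punchIn v j x k)))) ⟩
    M i j * x + apply A (λ i → removeAt (M i) j) v i ∎

  -- The first row becomes zero and is kept, so that apply-eliminate treats
  -- all rows alike.
  eliminate : ∀ {n m} → Matrix A (suc n) (suc m) → Fin (suc m) → Matrix A (suc n) m
  eliminate M j i k =
    M zero j * M i (punchIn j k) + - M i j * M zero (punchIn j k)

  eliminate-zero : ∀ {n m} (M : Matrix A (suc n) (suc m)) j k →
    eliminate M j zero k ≈ 0#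
  eliminate-zero M j k = begin
    a * r + - a * r  ≈⟨ distribʳ r a (- a) ⟨
    (a + - a) * r    ≈⟨ *-congʳ (-‿inverseʳ a) ⟩
    0# * r           ≈⟨ zeroˡ r ⟩
    0#               ∎
    where
    a = M zero j
    r = M zero (punchIn j k)

  -- The solution of the first equation with its denominator cleared: coordinate `j` should be minus
  -- the rest of the row divided by the pivot, so every other coordinate is multiplied by the pivot
  -- instead.
  backSubstitute : ∀ {n m} → Matrix A (suc n) (suc m) → Fin (suc m) →
    Vector Carrier m → Vector Carrier (suc m)
  backSubstitute M j v =
    insertAt (λ k → M zero j * v k) j (- apply A (λ i → removeAt (M i) j) v zero)

  apply-eliminate : ∀ {n m} (M : Matrix A (suc n) (suc m)) j v i →
    apply A M (backSubstitute M j v) i ≈ apply A (eliminate M j) v i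
  apply-eliminate M j v i = begin
    apply A M (backSubstitute M j v) i
      ≈⟨ apply-insertAt M (λ k → a * v k) j (- apply A R v zero) i ⟩
    b * - apply A R v zero + apply A R (λ k → a * v k) i
      -- The sign moves onto `b`, so that the semiring solver below can treat `- b` as an atom.
      ≈⟨ +-congʳ (trans (sym (-‿distribʳ-* b _)) (-‿distribˡ-* b _)) ⟩
    - b * apply A R v zero + apply A R (λ k → a * v k) i
      ≈⟨ +-congʳ (*-distribˡ-sum (- b) (λ k → R zero k * v k)) ⟩
    sum (λ k → - b * (R zero k * v k)) + apply A R (λ k → a * v k) i
      ≈⟨ ∑-distrib-+ (λ k → - b * (R zero k * v k)) (λ k → R i k * (a * v k)) ⟨
    sum (λ k → - b * (R zero k * v k) + R i k * (a * v k))
      ≈⟨ sum-cong-≋ (λ k → solve 5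
           (λ -b r₀ v r a → -b :* (r₀ :* v) :+ r :* (a :* v) := (a :* r :+ -b :* r₀) :* v)
           refl (- b) (R zero k) (v k) (R i k) a) ⟩
    apply A (eliminate M j) v i ∎
    where
    a = M zero j
    b = M i j
    R = λ i → removeAt (M i) j

  -- Back substitution lifts a kernel vector `v` of the eliminated matrix to one of `M`, whose
  -- coordinates other than `j` are those of `v` times the pivot; this is the extra factor next to
  -- `s`.
  eliminate-injectiveUpTo : ∀ {n m s} (M : Matrix A (suc n) (suc m)) j →
    IsInjectiveUpTo s M → IsInjectiveUpTo (s * M zero j) (tail (eliminate M j))
  eliminate-injectiveUpTo {s = s} M j inj v Ev≈0 k = begin
    s * M zero j * v k                         ≈⟨ *-assoc s (M zero j) (v k) ⟩
    s * (M zero j * v k)                       ≈⟨ *-congˡ (reflexive (insertAt-punchIn _ j _ k)) ⟨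
    s * backSubstitute M j v (punchIn j k)     ≈⟨ inj (backSubstitute M j v) Mw≈0 (punchIn j k) ⟩
    0#                                         ∎
    where
    Mw≈0 : ∀ i → apply A M (backSubstitute M j v) i ≈ 0#
    -- The hypothesis on `v` says nothing about this row, but elimination has made it zero.
    Mw≈0 zero    = trans (apply-eliminate M j v zero)
      (sum-zero λ k → trans (*-congʳ (eliminate-zero M j k)) (zeroˡ (v k)))
    Mw≈0 (suc i) = trans (apply-eliminate M j v (suc i)) (Ev≈0 i)

  module _ (reduced : IsReduced A) where

    -- The square of `x * y` is a multiple of `x * (x * y)`.
    x[xy]≈0⇒xy≈0 : ∀ x y → x * (x * y) ≈ 0# → x * y ≈ 0#
    x[xy]≈0⇒xy≈0 x y xxy≈0 = reduced (x * y) 2 (begin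
      -- The trailing `1#` comes from unfolding the exponent 2.
      x * y * (x * y * 1#)   ≈⟨ solve 3 (λ x y e → x :* y :* (x :* y :* e) := x :* (x :* y) :* (y :* e))
                                 refl x y 1# ⟩
      x * (x * y) * (y * 1#) ≈⟨ *-congʳ xxy≈0 ⟩
      0# * (y * 1#)          ≈⟨ zeroˡ (y * 1#) ⟩
      0#                     ∎)

    -- If the remaining rows kill `v`, then all of `M` kills `s v`; injectivity up to `s` then gives
    -- `s (s v) = 0`, and reducedness removes one factor.
    tail-injectiveUpTo : ∀ {n m s} (M : Matrix A (suc n) m) →
      (∀ j → s * M zero j ≈ 0#) → IsInjectiveUpTo s M → IsInjectiveUpTo s (tail M)
    tail-injectiveUpTo {s = s} M sM₀≈0 inj v Mv≈0 j =
      x[xy]≈0⇒xy≈0 s (v j) (inj (λ k → s * v k) Msv≈0 j)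
      where
      Msv≈0 : ∀ i → apply A M (λ k → s * v k) i ≈ 0#
      Msv≈0 zero    = sum-zero λ k → begin
        M zero k * (s * v k)  ≈⟨ x∙yz≈y∙xz (M zero k) s (v k) ⟩
        s * (M zero k * v k)  ≈⟨ *-assoc s (M zero k) (v k) ⟨
        s * M zero k * v k    ≈⟨ *-congʳ (sM₀≈0 k) ⟩
        0# * v k              ≈⟨ zeroˡ (v k) ⟩
        0#                    ∎
      Msv≈0 (suc i) = begin
        apply A M (λ k → s * v k) (suc i)  ≈⟨ apply-scale M s v (suc i) ⟩
        s * apply A M v (suc i)            ≈⟨ *-congˡ (Mv≈0 i) ⟩
        s * 0#                             ≈⟨ zeroʳ s ⟩
        0#                                 ∎

    injectiveUpTo⇒≈0 : ∀ {n m s} → n < m → (M : Matrix A n m) →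
      IsInjectiveUpTo s M → s ≈ 0#
    -- Without rows every vector is in the kernel, so the all-ones vector will do; there is a column
    -- to read it at.
    injectiveUpTo⇒≈0 {zero}  {suc m} {s} _ M inj =
      trans (sym (*-identityʳ s)) (inj (λ _ → 1#) (λ ()) zero)
    injectiveUpTo⇒≈0 {suc n} {suc m} n<m M inj =
      -- Dropping the row keeps all `suc m` columns, whereas the elimination below leaves `m`. Each
      -- entry serves as pivot in turn, so no entry has to be tested for being zero.
      injectiveUpTo⇒≈0 (m<n⇒m<1+n (s<s⁻¹ n<m)) (tail M)
        (tail-injectiveUpTo M
          (λ j → injectiveUpTo⇒≈0 (s<s⁻¹ n<m) (tail (eliminate M j))
                   (eliminate-injectiveUpTo M j inj))
          inj)

  injective⇒injectiveUpTo-1 : ∀ {n m} (M : Matrix A n m) →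
    IsInjectiveMatrix A M → IsInjectiveUpTo 1# M
  injective⇒injectiveUpTo-1 M inj v Mv≈0 j =
    trans (*-identityˡ (v j)) (inj {v} {λ _ → 0#} Mv≋M0 j)
    where
    Mv≋M0 : ∀ i → apply A M v i ≈ apply A M (λ _ → 0#) i
    Mv≋M0 i = trans (Mv≈0 i) (sym (sum-zero λ k → zeroʳ (M i k)))

mainTheorem3 : {c ℓ : Level} (A : CommutativeRing c ℓ) (n m : ℕ) →
    IsReduced A →
    n < m →
    (M : Matrix A n m) →
    IsInjectiveMatrix A M →
    CommutativeRing._≈_ A (CommutativeRing.1# A) (CommutativeRing.0# A)
mainTheorem3 A n m reduced n<m M inj =
  injectiveUpTo⇒≈0 A reduced n<m M (injective⇒injectiveUpTo-1 A M inj)
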